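{- Let $D=(V,A)$ be a finite connected complete monotone $r$-partite digraph with parts $V_1,\ldots,V_r$; that is, $V$ is the disjoint union of nonempty sets $V_1,\ldots,V_r$ and $A=\{(u,w): u\in V_i,\ w\in V_j,\ 1\le i<j\le r\}$. Define $s_r=|V_r|$ and $s_i=\max\{1+s_{i+1},|V_i|\}$ for $i=1,\ldots,r-1$. Then $$\eta_t(D)=\max\left\{\left\lceil\frac{s_i}{|V_i|}\right\rceil : i=1,\ldots,r\right\}.$$
   Context: For a directed acyclic graph $D=(V,A)$, $N(v)$ denotes the set of neighbors of $v$ in the undirected underlying graph $G(D)$ of $D$ (both in- and out-neighbors). $\mathbb{N}$ denotes the positive integers. For a labeling $f:V\to\mathbb{N}$, put $S(v)=\sum_{w\in N(v)}f(w)$. The labeling $f$ is a topological additive numbering of $D$ if $S(u)<S(v)$ for every $(u,v)\in A$; it is a topological additive $k$-numbering if moreover $k$ is the largest label used in $f$. If $D$ has at least one topological additive numbering, $\eta_t(D)$ is the least $k$ for which $D$ has a topological additive $k$-numbering; the assertion includes that $\eta_t(D)$ is defined, i.e. that $D$ has a topological additive numbering. A digraph $D$ is (complete) $r$-partite if $G(D)$ is (complete) $r$-partite, and an $r$-partite digraph is monotone if it can be partitioned into $V_1,\ldots,V_r$ (the parts, each an independent set) so that every arc in $V_i\times V_j$ satisfies $i<j$. -}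

module Defs where

open import Data.Nat using (ℕ; zero; suc; _+_; _∸_; _⊔_; _/_; _≤_; _<_; NonZero; >-nonZero)
open import Data.Nat.ListAction using (sum)
open import Data.Fin using (Fin; zero; suc; _≟_)
import Data.Fin as Fin
open import Data.List using (List; map; filter; length; allFin)
open import Data.List.Membership.Propositional.Properties using (∈-filter⁺; ∈-allFin; ∈-length)
open import Data.Product using (∃; ∃-syntax; _×_; _,_)
open import Data.Sum using (_⊎_)
open import Function using (_∘_)
open import Function.Bundles using (_⇔_)
open import Level using (0ℓ)
open import Relation.Binary using (Rel; Decidable)
open import Relation.Binary.Construct.Closure.ReflexiveTransitive using (Star)
open import Relation.Binary.PropositionalEquality using (_≡_)
open import Relation.Nullary.Decidable using (_⊎-dec_)

record Digraph (n : ℕ) : Set₁ where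
  field
    Arc  : Rel (Fin n) 0ℓ
    arc? : Decidable Arc

  Adjacent : Rel (Fin n) 0ℓ
  Adjacent u v = Arc u v ⊎ Arc v u

  adjacent? : Decidable Adjacent
  adjacent? u v = arc? u v ⊎-dec arc? v u

  Connected : Set
  Connected = ∀ u v → Star Adjacent u v

  -- Duplicate-free, so summing over it is summing over the set N(v).
  N : Fin n → List (Fin n)
  N v = filter (adjacent? v) (allFin n)

  S : (Fin n → ℕ) → Fin n → ℕ
  S f v = sum (map f (N v))

  record TopologicalAdditiveNumbering (f : Fin n → ℕ) : Set where
    field
      positive   : ∀ v → 0 < f v
      increasing : ∀ {u v} → Arc u v → S f u < S f v

  record TopologicalAdditiveNumberingWithMax (k : ℕ) (f : Fin n → ℕ) : Set where
    field
      numbering : TopologicalAdditiveNumbering f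
      bounded   : ∀ v → f v ≤ k
      attained  : ∃[ v ] f v ≡ k

open Digraph public using (Connected)

-- ηₜ is partial, so it is given by its graph: ηₜ[ D ]≡ k says that ηₜ(D) is
-- defined and equal to k.
ηₜ[_]≡_ : ∀ {n} → Digraph n → ℕ → Set
ηₜ[ D ]≡ k =
  ∃ (TopologicalAdditiveNumberingWithMax k) ×
  (∀ l → ∃ (TopologicalAdditiveNumberingWithMax l) → k ≤ l)
  where open Digraph D

-- The parts are the fibres V i = { v ∣ part v ≡ i }.
record CompleteMonotonePartition {n} (D : Digraph n) (r : ℕ) : Set where
  open Digraph D
  field
    part     : Fin n → Fin r
    nonempty : ∀ i → ∃[ v ] part v ≡ i
    arcs     : ∀ u w → Arc u w ⇔ part u Fin.< part w

  V : Fin r → List (Fin n)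
  V i = filter (λ v → part v ≟ i) (allFin n)

  ∣V_∣ : Fin r → ℕ
  ∣V i ∣ = length (V i)

  ∣V∣-nonZero : ∀ i → NonZero ∣V i ∣
  ∣V∣-nonZero i with nonempty i
  ... | v , v∈Vᵢ = >-nonZero (∈-length (∈-filter⁺ (λ w → part w ≟ i) (∈-allFin v) v∈Vᵢ))

-- The sequence s₁, …, sᵣ computed from the part sizes c; the recursion drops the
-- first part, since sᵢ depends only on the parts from i onwards.
s : ∀ {r} → (Fin (suc r) → ℕ) → Fin (suc r) → ℕ
s {zero}  c zero    = c zero
s {suc r} c zero    = (1 + s (c ∘ suc) zero) ⊔ c zero
s {suc r} c (suc i) = s (c ∘ suc) i

⌈_/_⌉ : (m n : ℕ) .{{_ : NonZero n}} → ℕ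
⌈ m / n ⌉ = (m + (n ∸ 1)) / n

{-# OPTIONS --safe #-}

-- Let T be the sum of all labels and Fᵢ the sum of the labels on Vᵢ. Since D is
-- complete multipartite, S(v) = T − Fᵢ for v ∈ Vᵢ, so f is a topological additive
-- numbering exactly when its labels are positive and F₁ > F₂ > … > Fᵣ. As Fᵢ ≥ |Vᵢ|,
-- this forces Fᵢ ≥ sᵢ, whereas labels at most k give Fᵢ ≤ k|Vᵢ|; hence
-- k ≥ ⌈sᵢ/|Vᵢ|⌉. Conversely, if |Vᵢ| ≤ sᵢ ≤ k|Vᵢ| for all i, labels between 1 and k
-- can be distributed over each Vᵢ so that Fᵢ = sᵢ.
module Submission where

open import Data.Nat
  using (ℕ; zero; suc; _+_; _*_; _∸_; _%_; _⊓_; _≤_; _<_; z≤n; s≤s; s≤s⁻¹; z<s; NonZero; >-nonZero⁻¹)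
open import Data.Nat.DivMod using (m≡m%n+[m/n]*n; m%n<n; m<n*o⇒m/o<n)
open import Data.Nat.ListAction using (sum)
open import Data.Nat.Properties
open import Data.Nat.Solver using (module +-*-Solver)
open import Data.Fin using (Fin; zero; suc)
import Data.Fin as Fin
import Data.Fin.Properties as Fin
open import Data.List using (List; []; _∷_; map; filter; length; allFin; tabulate)
open import Data.List.Extrema.Nat using (max; max≤v⁺; xs≤max)
open import Data.List.Properties using (map-cong-local; filter-≐)
open import Data.List.Relation.Unary.All as All using ([]; _∷_)
open import Data.List.Relation.Unary.All.Properties using (all-filter; tabulate⁺; tabulate⁻)
open import Data.List.Relation.Unary.AllPairs using ([]; _∷_)
open import Data.List.Relation.Unary.Unique.Propositional using (Unique)
import Data.List.Relation.Unary.Unique.Propositional.Properties as Unique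
open import Data.Product using (∃-syntax; _×_; _,_; proj₁; proj₂)
open import Data.Sum using (inj₁; inj₂)
open import Data.Vec.Functional using (updateAt)
open import Data.Vec.Functional.Properties using (updateAt-updates; updateAt-minimal)
open import Function using (_∘_; const)
open import Function.Bundles using (Equivalence)
open import Relation.Binary using (tri<; tri≈; tri>)
open import Relation.Binary.PropositionalEquality
  using (_≡_; _≢_; refl; sym; trans; cong; cong₂; subst₂; module ≡-Reasoning)
open import Relation.Nullary using (yes; no; contradiction)
open import Relation.Nullary.Decidable using (¬?)
open import Relation.Unary using (Pred; Decidable)
open import Defs

-- Sums of labels over lists

module _ {a} {A : Set a} (f : A → ℕ) where

  sum-filter-¬+sum-filter : ∀ {p} {P : Pred A p} (P? : Decidable P) xs →
    sum (map f (filter (¬? ∘ P?) xs)) + sum (map f (filter P? xs)) ≡ sum (map f xs)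
  sum-filter-¬+sum-filter P? [] = refl
  sum-filter-¬+sum-filter P? (x ∷ xs) with P? x
  ... | no  _ = trans (+-assoc (f x) _ _) (cong (f x +_) (sum-filter-¬+sum-filter P? xs))
  ... | yes _ = begin
    m + (f x + n)  ≡⟨ solve 3 (λ m y n → m :+ (y :+ n) := y :+ (m :+ n)) refl m (f x) n ⟩
    f x + (m + n)  ≡⟨ cong (f x +_) (sum-filter-¬+sum-filter P? xs) ⟩
    f x + sum (map f xs) ∎
    where
    open ≡-Reasoning
    open +-*-Solver
    m = sum (map f (filter (¬? ∘ P?) xs))
    n = sum (map f (filter P? xs))

  length≤sum : (∀ x → 0 < f x) → ∀ xs → length xs ≤ sum (map f xs)
  length≤sum 0<f []       = z≤n
  length≤sum 0<f (x ∷ xs) = +-mono-≤ (0<f x) (length≤sum 0<f xs)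

  sum≤*length : ∀ {k} → (∀ x → f x ≤ k) → ∀ xs → sum (map f xs) ≤ length xs * k
  sum≤*length f≤k []       = z≤n
  sum≤*length f≤k (x ∷ xs) = +-mono-≤ (f≤k x) (sum≤*length f≤k xs)

-- Greedy filling: every entry starts with label 1, and `d` is the excess still to be handed out.
-- The head takes as much as it can, `k ⊓ d`, and leaves `d ∸ k` to the tail.
distribute : ∀ {n} k (xs : List (Fin n)) → Unique xs → ∀ d → d ≤ length xs * k →
  ∃[ g ] (∀ x → 0 < g x × g x ≤ suc k) × sum (map g xs) ≡ length xs + d
distribute k [] _ zero _ = const 1 , (λ _ → z<s , s≤s z≤n) , refl
distribute k (x ∷ xs) (x∉xs ∷ xs!) d d≤
  with g , g-bounds , Σg ← distribute k xs xs! (d ∸ k) (m≤n+o⇒m∸n≤o d k d≤)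
  = g′ , bounds , total
  where
  g′ = updateAt g x (const (suc (k ⊓ d)))

  bounds : ∀ y → 0 < g′ y × g′ y ≤ suc k
  bounds y with y Fin.≟ x
  ... | yes refl rewrite updateAt-updates x {const (suc (k ⊓ d))} g = z<s , s≤s (m⊓n≤m k d)
  ... | no y≢x rewrite updateAt-minimal y x {const (suc (k ⊓ d))} g y≢x = g-bounds y

  total : sum (map g′ (x ∷ xs)) ≡ suc (length xs) + d
  total = begin
    g′ x + sum (map g′ xs)
      -- Since `x` does not recur in `xs`, the update leaves the labels of the tail intact.
      ≡⟨ cong₂ _+_ (updateAt-updates x g)
           (cong sum (map-cong-local (All.map (λ {y} x≢y → updateAt-minimal y x g (x≢y ∘ sym)) x∉xs))) ⟩
    suc (k ⊓ d) + sum (map g xs)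
      ≡⟨ cong (suc (k ⊓ d) +_) Σg ⟩
    suc (k ⊓ d) + (length xs + (d ∸ k))
      ≡⟨ solve 3 (λ a l b → con 1 :+ a :+ (l :+ b) := con 1 :+ l :+ (a :+ b)) refl
           (k ⊓ d) (length xs) (d ∸ k) ⟩
    suc (length xs) + (k ⊓ d + (d ∸ k))
      ≡⟨ cong (suc (length xs) +_) (m⊓n+n∸m≡n k d) ⟩
    suc (length xs) + d ∎
    where
    open ≡-Reasoning
    open +-*-Solver

-- Rounded-up quotients as least multipliers

m≤n*o⇒⌈m/n⌉≤o : ∀ m n o .{{_ : NonZero n}} → m ≤ n * o → ⌈ m / n ⌉ ≤ o
-- The divisor is `suc n`, so the numerator gains only `n` and stays strictly below the next
-- multiple, `suc o * suc n`.
m≤n*o⇒⌈m/n⌉≤o m (suc n) o m≤ = s≤s⁻¹ (m<n*o⇒m/o<n (begin-strict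
  m + n                <⟨ +-mono-≤-< m≤ (n<1+n n) ⟩
  suc n * o + suc n    ≡⟨ +-comm (suc n * o) (suc n) ⟩
  suc n + suc n * o    ≡⟨ cong (suc n +_) (*-comm (suc n) o) ⟩
  suc o * suc n        ∎))
  where open ≤-Reasoning

m≤n*⌈m/n⌉ : ∀ m n .{{_ : NonZero n}} → m ≤ n * ⌈ m / n ⌉
m≤n*⌈m/n⌉ m (suc n) = +-cancelʳ-≤ n m _ (begin
  m + n                               ≡⟨ m≡m%n+[m/n]*n (m + n) (suc n) ⟩
  -- The remainder is at most `n`, exactly the amount added for rounding up, so it cancels.
  (m + n) % suc n + q * suc n         ≤⟨ +-monoˡ-≤ (q * suc n) (s≤s⁻¹ (m%n<n (m + n) (suc n))) ⟩
  n + q * suc n                       ≡⟨ +-comm n (q * suc n) ⟩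
  q * suc n + n                       ≡⟨ cong (_+ n) (*-comm q (suc n)) ⟩
  suc n * q + n                       ∎)
  where
  open ≤-Reasoning
  q = ⌈ m / suc n ⌉

c≤s : ∀ {r} (c : Fin (suc r) → ℕ) i → c i ≤ s c i
c≤s {zero}  c zero    = ≤-refl
c≤s {suc r} c zero    = m≤n⊔m _ (c zero)
c≤s {suc r} c (suc i) = c≤s (c ∘ suc) i

s-decreasing : ∀ {r} (c : Fin (suc r) → ℕ) {i j} → i Fin.< j → s c j < s c i
s-decreasing {suc r} c {zero} {suc zero} _ = m≤m⊔n _ (c zero)
s-decreasing {suc (suc r)} c {zero} {suc (suc j)} _ =
  <-trans (s-decreasing (c ∘ suc) {zero} {suc j} z<s) (m≤m⊔n _ (c zero))
s-decreasing {suc r} c {suc i} {suc j} i<j = s-decreasing (c ∘ suc) (s≤s⁻¹ i<j)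

-- Both arguments of the maximum defining `s` are forced on `F`: the size bound by hypothesis, and
-- one more than the next term by strict decrease and induction on the remaining parts.
s-least : ∀ {r} (c F : Fin (suc r) → ℕ) → (∀ i → c i ≤ F i) →
  (∀ {i j} → i Fin.< j → F j < F i) → ∀ i → s c i ≤ F i
s-least {zero}  c F c≤F F↓ zero    = c≤F zero
s-least {suc r} c F c≤F F↓ zero    =
  ⊔-lub (≤-<-trans (s-least (c ∘ suc) (F ∘ suc) (c≤F ∘ suc) (F↓ ∘ s≤s) zero) (F↓ z<s)) (c≤F zero)
s-least {suc r} c F c≤F F↓ (suc i) = s-least (c ∘ suc) (F ∘ suc) (c≤F ∘ suc) (F↓ ∘ s≤s) i

-- Numberings in terms of part sums

module _ {n r} {D : Digraph n} (P : CompleteMonotonePartition D (suc r)) where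
  open Digraph D
  open CompleteMonotonePartition P

  F : (Fin n → ℕ) → Fin (suc r) → ℕ
  F f i = sum (map f (V i))

  adjacent⇒≢ : ∀ {u v} → Adjacent u v → part v ≢ part u
  adjacent⇒≢ (inj₁ uv) eq = Fin.<⇒≢ (Equivalence.to (arcs _ _) uv) (sym eq)
  adjacent⇒≢ (inj₂ vu) eq = Fin.<⇒≢ (Equivalence.to (arcs _ _) vu) eq

  ≢⇒adjacent : ∀ {u v} → part v ≢ part u → Adjacent u v
  ≢⇒adjacent {u} {v} v≢u with Fin.<-cmp (part u) (part v)
  ... | tri< u<v _ _ = inj₁ (Equivalence.from (arcs u v) u<v)
  ... | tri≈ _ u≡v _ = contradiction (sym u≡v) v≢u
  ... | tri> _ _ v<u = inj₂ (Equivalence.from (arcs v u) v<u)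

  -- The vertices not adjacent to `v` are those of its own part, `v` included, so the two sums split
  -- the vertex set.
  S+F≡total : ∀ f v → S f v + F f (part v) ≡ sum (map f (allFin n))
  S+F≡total f v = trans
    (cong (λ xs → sum (map f xs) + F f (part v))
      (filter-≐ (adjacent? v) (¬? ∘ inPart?) (adjacent⇒≢ , ≢⇒adjacent) (allFin n)))
    (sum-filter-¬+sum-filter f inPart? (allFin n))
    where
    inPart? : Decidable (λ w → part w ≡ part v)
    inPart? w = part w Fin.≟ part v

  S<⇒F> : ∀ f {u v} → S f u < S f v → F f (part v) < F f (part u)
  S<⇒F> f {u} {v} Su<Sv = ≰⇒> λ Fu≤Fv →
    <⇒≢ (+-mono-<-≤ Su<Sv Fu≤Fv) (trans (S+F≡total f u) (sym (S+F≡total f v)))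

  F>⇒S< : ∀ f {u v} → F f (part v) < F f (part u) → S f u < S f v
  F>⇒S< f {u} {v} Fv<Fu = ≰⇒> λ Sv≤Su →
    <⇒≢ (+-mono-≤-< Sv≤Su Fv<Fu) (trans (S+F≡total f v) (sym (S+F≡total f u)))

  -- Nonempty parts supply an arc between any two of them, which turns a condition on arcs into one
  -- on indices.
  numbering⇒F-decreasing : ∀ {f} → TopologicalAdditiveNumbering f →
    ∀ {i j} → i Fin.< j → F f j < F f i
  numbering⇒F-decreasing {f} num {i} {j} i<j with nonempty i | nonempty j
  ... | u , refl | v , refl = S<⇒F> f (increasing (Equivalence.from (arcs u v) i<j))
    where open TopologicalAdditiveNumbering num

  numbering⇒s≤ : ∀ {f k} → TopologicalAdditiveNumbering f → (∀ v → f v ≤ k) →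
    ∀ i → s ∣V_∣ i ≤ ∣V i ∣ * k
  numbering⇒s≤ {f} num f≤k i = ≤-trans
    (s-least ∣V_∣ (F f) (length≤sum f positive ∘ V) (numbering⇒F-decreasing num) i)
    (sum≤*length f f≤k (V i))
    where open TopologicalAdditiveNumbering num

  s≤⇒numbering : ∀ k → (∀ i → s ∣V_∣ i ≤ ∣V i ∣ * suc k) →
    ∃[ f ] TopologicalAdditiveNumbering f × (∀ v → f v ≤ suc k)
  s≤⇒numbering k s≤ = f , record { positive = λ v → proj₁ (bounds v) ; increasing = incr }
                        , λ v → proj₂ (bounds v)
    where
    -- One unit per vertex is spent on positivity; each vertex can then absorb at most `k` more.
    excess≤ : ∀ i → s ∣V_∣ i ∸ ∣V i ∣ ≤ ∣V i ∣ * k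
    excess≤ i = m≤n+o⇒m∸n≤o (s ∣V_∣ i) ∣V i ∣
      (≤-trans (s≤ i) (≤-reflexive (*-suc ∣V i ∣ k)))

    labels : ∀ i → ∃[ g ] (∀ v → 0 < g v × g v ≤ suc k) ×
      sum (map g (V i)) ≡ ∣V i ∣ + (s ∣V_∣ i ∸ ∣V i ∣)
    labels i = distribute k (V i) (Unique.filter⁺ _ (Unique.allFin⁺ n)) _ (excess≤ i)

    f : Fin n → ℕ
    f v = proj₁ (labels (part v)) v

    bounds : ∀ v → 0 < f v × f v ≤ suc k
    bounds v = proj₁ (proj₂ (labels (part v))) v

    F≡s : ∀ i → F f i ≡ s ∣V_∣ i
    F≡s i = begin
      sum (map f (V i))
        -- On `V i` the glued labeling `f` reads its values from `labels i`.
        ≡⟨ cong sum (map-cong-local (All.map (λ {v} v∈Vᵢ → cong (λ j → proj₁ (labels j) v) v∈Vᵢ)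
                                             (all-filter (λ v → part v Fin.≟ i) (allFin n)))) ⟩
      sum (map (proj₁ (labels i)) (V i))
        ≡⟨ proj₂ (proj₂ (labels i)) ⟩
      ∣V i ∣ + (s ∣V_∣ i ∸ ∣V i ∣)
        ≡⟨ m+[n∸m]≡n (c≤s ∣V_∣ i) ⟩
      s ∣V_∣ i ∎
      where open ≡-Reasoning

    incr : ∀ {u v} → Arc u v → S f u < S f v
    incr {u} {v} uv = F>⇒S< f (subst₂ _<_ (sym (F≡s (part v))) (sym (F≡s (part u)))
      (s-decreasing ∣V_∣ (Equivalence.to (arcs u v) uv)))

  -- Reduces the problem to finding the least multiplier that works for all parts. The bound 0 is
  -- excluded because the first part is nonempty.
  ηₜ-characterization : ∀ k → (∀ i → s ∣V_∣ i ≤ ∣V i ∣ * k) →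
    (∀ l → (∀ i → s ∣V_∣ i ≤ ∣V i ∣ * l) → k ≤ l) → ηₜ[ D ]≡ k
  ηₜ-characterization zero s≤ _ = contradiction
    (≤-trans (c≤s ∣V_∣ zero) (≤-trans (s≤ zero) (≤-reflexive (*-zeroʳ ∣V zero ∣))))
    (<⇒≱ (>-nonZero⁻¹ ∣V zero ∣ {{∣V∣-nonZero zero}}))
  ηₜ-characterization (suc k) s≤ least with s≤⇒numbering k s≤
  ... | f , num , f≤k = (f , record { numbering = num ; bounded = f≤k ; attained = attained′ }) ,
      λ l (_ , numₗ) → let open TopologicalAdditiveNumberingWithMax numₗ in
        least l (numbering⇒s≤ numbering bounded)
    where
    attained′ : ∃[ v ] f v ≡ suc k
    attained′ with Fin.any? (λ v → f v ≟ suc k)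
    ... | yes att = att
    -- If no label equals `suc k`, all labels are at most `k`, so `k` already satisfies the
    -- inequalities, against minimality.
    ... | no ¬att = contradiction
      (least k (numbering⇒s≤ num (λ v → s≤s⁻¹ (≤∧≢⇒< (f≤k v) (λ eq → ¬att (v , eq))))))
      1+n≰n

proposition3 : ∀ {n r : ℕ} (D : Digraph n) → Connected D →
    (P : CompleteMonotonePartition D (suc r)) →
    let open CompleteMonotonePartition P in
    ηₜ[ D ]≡ max 0 (tabulate (λ (i : Fin (suc r)) → ⌈ s ∣V_∣ i / ∣V i ∣ ⌉ {{∣V∣-nonZero i}}))
proposition3 {r = r} D _ P = ηₜ-characterization P (max 0 (tabulate ratio))
  (λ i → ≤-trans (m≤n*⌈m/n⌉ (s ∣V_∣ i) ∣V i ∣ {{∣V∣-nonZero i}})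
    (*-monoʳ-≤ ∣V i ∣ (tabulate⁻ {f = ratio} (xs≤max 0 (tabulate ratio)) i)))
  -- The initial value 0 of `max` lies below every `l`, so only the ratios have to be compared with
  -- `l`.
  (λ l s≤ → max≤v⁺ z≤n
    (tabulate⁺ {f = ratio} (λ i → m≤n*o⇒⌈m/n⌉≤o (s ∣V_∣ i) ∣V i ∣ l {{∣V∣-nonZero i}} (s≤ i))))
  where
  open CompleteMonotonePartition P
  ratio : Fin (suc r) → ℕ
  ratio i = ⌈ s ∣V_∣ i / ∣V i ∣ ⌉ {{∣V∣-nonZero i}}
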